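{- Let $s\ge 1$ be a fixed integer. Let $\mathcal{F}$ be a family of subsets of $[n]$ that contains no $s+1$ different sets $B,C_1,\dots,C_s$ such that $B\subset C_i$ for all $1\le i\le s$ and $|C_1|=|C_2|=\dots=|C_s|$. Then $$|\mathcal{F}|\le \left(1+\frac{2(s-1)}{n}+O\left(\frac{\sqrt{\log n}}{n^{3/2}}\right)\right)\binom{n}{\lfloor\frac{n}{2}\rfloor},$$ where the implied constant in the $O(\cdot)$ term does not depend on $n$ (as $n\to\infty$).
   Context: $[n]=\{1,2,\dots,n\}$. -}

module Defs where

open import Data.Nat using (ℕ; _*_; _∸_; _+_)
open import Data.Fin using (Fin)
open import Data.Fin.Subset using (Subset; _⊂_; ∣_∣)
open import Data.List using (List)
open import Data.List.Membership.Propositional using (_∈_)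
open import Data.Product using (Σ; _×_)
open import Function.Definitions using (Injective)
open import Relation.Binary.PropositionalEquality using (_≡_)

-- A family of subsets of [n] is a duplicate-free list of subsets (Unique is imposed
-- in the statement); its size |F| is the length of the list.

-- F contains s+1 different sets B, C_1, ..., C_s with B ⊂ C_i (strict) for all i
-- and |C_1| = ... = |C_s|.  Distinctness: C is injective, and B ≠ C_i follows
-- from strict inclusion.
HasConfig : (s n : ℕ) → List (Subset n) → Set
HasConfig s n F =
  Σ (Subset n) λ B → Σ (Fin s → Subset n) λ C →
    (B ∈ F)
    × ((i : Fin s) → C i ∈ F)
    × Injective _≡_ _≡_ C
    × ((i : Fin s) → B ⊂ C i)
    × ((i j : Fin s) → ∣ C i ∣ ≡ ∣ C j ∣)

sq∸ : ℕ → ℕ → ℕ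
sq∸ a b = (a ∸ b) * (a ∸ b)

{-# OPTIONS --safe #-}

-- Weigh X ∈ F by |X|! (n - |X|)!, the number of maximal chains of subsets of [n] through X.
-- A chain meeting F in h sets contains at least h - 1 pairs X ⊂ Y of members of F, so the
-- total weight exceeds n! by at most the number of incidences of chains with such pairs. If
-- F is confined to sizes near n/2, each X has at most s - 1 supersets per level, which makes
-- this number at most a fraction (s - 1)(1/m + O(1/m²)) of the weight of X, m = n - |X|.
-- For |X| = n/2 + d this fraction exceeds 2(s - 1)/n + O(1/n²) by O(d/n²), but the weight of X exceeds
-- that of a middle set by a factor 1 + Ω(d²/n), which is more. So every size within Ω(n) of
-- n/2 is handled at once, with error O(1/n²); the other sizes are negligible, because their
-- weights are larger than the middle one by a factor of order n³.
module Submission where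

open import Defs
open import Data.Nat
open import Data.Nat.Properties
open import Data.Nat.Combinatorics using (_C_; nCk≡n!/k![n-k]!; k![n∸k]!∣n!)
open import Data.Nat.DivMod using (m≡m%n+[m/n]*n; m%n<n; m/n*n≤m; m/n*n≡m; /-monoˡ-≤)
open import Data.Nat.ListAction using (sum)
open import Data.Nat.Logarithm using (⌊log₂_⌋; ⌊log₂⌋-mono-≤)
open import Data.Nat.Tactic.RingSolver using (solve-∀)
open import Data.Fin using (Fin; inject≤)
open import Data.Fin.Properties using (inject≤-injective)
open import Data.Fin.Subset using (Subset; inside; outside; ∣_∣; _⊂_; ⊤)
open import Data.Fin.Subset.Properties using (s⊂s; out⊂in; ∣⊤∣≡n; ∣p∣≤n; _⊂?_)
open import Data.List using (List; []; _∷_; length; map; filter; lookup)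
open import Data.List.Membership.Propositional using (_∈_)
open import Data.List.Membership.Propositional.Properties using (∈-filter⁻; ∈-lookup)
open import Data.List.Relation.Unary.All using (All; []; _∷_)
import Data.List.Relation.Unary.All as All
open import Data.List.Relation.Unary.Any using (here; there)
open import Data.List.Relation.Unary.AllPairs using ([]; _∷_)
open import Data.List.Relation.Unary.Unique.Propositional using (Unique)
open import Data.List.Relation.Unary.Unique.Propositional.Properties using (filter⁺)
open import Data.Product using (Σ; _×_; _,_; proj₁; proj₂)
open import Data.Vec using ([]; _∷_)
open import Function using (_∘_)
open import Level using (0ℓ)
open import Relation.Binary.PropositionalEquality
open import Relation.Nullary using (¬_; Dec; yes; no; contradiction)
open import Relation.Nullary.Decidable using (_×-dec_)
open import Relation.Unary using (Pred; Decidable)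
open import Relation.Unary.Properties using (∁?)

private variable
  A : Set
  n : ℕ

-- Finite sums indexed by lists

interchange : ∀ a b c d → (a + b) + (c + d) ≡ (a + c) + (b + d)
interchange = solve-∀

∑ : List A → (A → ℕ) → ℕ
∑ xs f = sum (map f xs)

∑-cong : ∀ (xs : List A) {f g : A → ℕ} → (∀ x → f x ≡ g x) → ∑ xs f ≡ ∑ xs g
∑-cong []       eq = refl
∑-cong (x ∷ xs) eq = cong₂ _+_ (eq x) (∑-cong xs eq)

∑-mono : ∀ (xs : List A) {f g : A → ℕ} → (∀ {x} → x ∈ xs → f x ≤ g x) → ∑ xs f ≤ ∑ xs g
∑-mono []       le = z≤n
∑-mono (x ∷ xs) le = +-mono-≤ (le (here refl)) (∑-mono xs (le ∘ there))

∑-+ : ∀ (xs : List A) (f g : A → ℕ) → ∑ xs (λ x → f x + g x) ≡ ∑ xs f + ∑ xs g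
∑-+ []       f g = refl
∑-+ (x ∷ xs) f g = trans (cong ((f x + g x) +_) (∑-+ xs f g))
                         (interchange (f x) (g x) (∑ xs f) (∑ xs g))

∑-*ˡ : ∀ (xs : List A) c (f : A → ℕ) → ∑ xs (λ x → c * f x) ≡ c * ∑ xs f
∑-*ˡ []       c f = sym (*-zeroʳ c)
∑-*ˡ (x ∷ xs) c f = trans (cong (c * f x +_) (∑-*ˡ xs c f)) (sym (*-distribˡ-+ c (f x) _))

∑-const : ∀ (xs : List A) c → ∑ xs (λ _ → c) ≡ length xs * c
∑-const []       c = refl
∑-const (x ∷ xs) c = cong (c +_) (∑-const xs c)

∑-zero : ∀ (xs : List A) → ∑ xs (λ _ → 0) ≡ 0
∑-zero xs = trans (∑-const xs 0) (*-zeroʳ (length xs))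

∑-swap : ∀ {B : Set} (xs : List A) (ys : List B) (f : A → B → ℕ) →
         ∑ xs (λ x → ∑ ys (f x)) ≡ ∑ ys (λ y → ∑ xs (λ x → f x y))
∑-swap []       ys f = sym (∑-zero ys)
∑-swap (x ∷ xs) ys f = trans (cong (∑ ys (f x) +_) (∑-swap xs ys f))
                             (sym (∑-+ ys (f x) (λ y → ∑ xs (λ z → f z y))))

length-filter-∁ : ∀ {P : Pred A 0ℓ} (P? : Decidable P) (xs : List A) →
                  length xs ≡ length (filter P? xs) + length (filter (∁? P?) xs)
length-filter-∁ P? []       = refl
length-filter-∁ P? (x ∷ xs) with P? x
... | yes _ = cong suc (length-filter-∁ P? xs)
... | no  _ = trans (cong suc (length-filter-∁ P? xs)) (sym (+-suc _ _))

lookup-injective : {xs : List A} → Unique xs → ∀ {i j} → lookup xs i ≡ lookup xs j → i ≡ j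
lookup-injective (_  ∷ _) {Fin.zero}  {Fin.zero}  _  = refl
lookup-injective (x∉ ∷ _) {Fin.zero}  {Fin.suc j} eq = contradiction eq (All.lookup x∉ (∈-lookup j))
lookup-injective (x∉ ∷ _) {Fin.suc i} {Fin.zero}  eq = contradiction (sym eq) (All.lookup x∉ (∈-lookup i))
lookup-injective (_  ∷ u) {Fin.suc i} {Fin.suc j} eq = cong Fin.suc (lookup-injective u eq)

-- Sums over the one-element deletions of a set

-- Sum of f (A \ {i}) over the elements i of A.
deletions : (Subset n → ℕ) → Subset n → ℕ
deletions f []            = 0
deletions f (outside ∷ A) = deletions (f ∘ (outside ∷_)) A
deletions f (inside  ∷ A) = f (outside ∷ A) + deletions (f ∘ (inside ∷_)) A

-- The comparison is asked only of sets with one element less, so that an induction on size can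
-- supply it.
deletions-mono : ∀ {f g : Subset n → ℕ} A → (∀ B → suc ∣ B ∣ ≡ ∣ A ∣ → f B ≤ g B) →
                 deletions f A ≤ deletions g A
deletions-mono []            le = z≤n
deletions-mono (outside ∷ A) le = deletions-mono A (λ B → le (outside ∷ B))
deletions-mono (inside  ∷ A) le =
  +-mono-≤ (le (outside ∷ A) refl) (deletions-mono A (λ B eq → le (inside ∷ B) (cong suc eq)))

deletions-+ : ∀ (f g : Subset n → ℕ) A →
              deletions (λ B → f B + g B) A ≡ deletions f A + deletions g A
deletions-+ f g []            = refl
deletions-+ f g (outside ∷ A) = deletions-+ (f ∘ (outside ∷_)) (g ∘ (outside ∷_)) A
deletions-+ f g (inside  ∷ A) =
  trans (cong (f (outside ∷ A) + g (outside ∷ A) +_) (deletions-+ (f ∘ (inside ∷_)) (g ∘ (inside ∷_)) A))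
        (interchange (f (outside ∷ A)) (g (outside ∷ A)) _ _)

deletions-*ˡ : ∀ c (f : Subset n → ℕ) A → deletions (λ B → c * f B) A ≡ c * deletions f A
deletions-*ˡ c f []            = sym (*-zeroʳ c)
deletions-*ˡ c f (outside ∷ A) = deletions-*ˡ c (f ∘ (outside ∷_)) A
deletions-*ˡ c f (inside  ∷ A) =
  trans (cong (c * f (outside ∷ A) +_) (deletions-*ˡ c (f ∘ (inside ∷_)) A)) (sym (*-distribˡ-+ c _ _))

deletions-zero : ∀ (A : Subset n) → deletions (λ _ → 0) A ≡ 0
deletions-zero []            = refl
deletions-zero (outside ∷ A) = deletions-zero A
deletions-zero (inside  ∷ A) = deletions-zero A

deletions-∑ : ∀ (xs : List A) (f : A → Subset n → ℕ) B →
              deletions (λ D → ∑ xs (λ x → f x D)) B ≡ ∑ xs (λ x → deletions (f x) B)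
deletions-∑ []       f B = deletions-zero B
deletions-∑ (x ∷ xs) f B =
  trans (deletions-+ (f x) _ B) (cong (deletions (f x) B +_) (deletions-∑ xs f B))

deletions-size : ∀ (g : ℕ → ℕ) (A : Subset n) →
                 deletions (λ B → g ∣ B ∣) A ≡ ∣ A ∣ * g (pred ∣ A ∣)
deletions-size g []            = refl
deletions-size g (outside ∷ A) = deletions-size g A
deletions-size g (inside  ∷ A) with ∣ A ∣ | deletions-size (g ∘ suc) A
... | zero  | eq = cong (g 0 +_) eq
... | suc a | eq = cong (g (suc a) +_) eq

-- Strict only for the empty set, which has no deletions while 0! is 1.
deletions-! : ∀ (A : Subset n) → deletions (λ B → ∣ B ∣ !) A ≤ ∣ A ∣ !
deletions-! A with ∣ A ∣ | deletions-size _! A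
... | zero  | eq = ≤-trans (≤-reflexive eq) z≤n
... | suc a | eq = ≤-reflexive eq

-- Functions of the size difference of nested sets

-- onGap g B A is g (|A| - |B|) if B ⊆ A, and 0 otherwise.
onGap : (ℕ → ℕ) → Subset n → Subset n → ℕ
onGap g []            []            = g 0
onGap g (inside  ∷ B) (outside ∷ A) = 0
onGap g (inside  ∷ B) (inside  ∷ A) = onGap g B A
onGap g (outside ∷ B) (outside ∷ A) = onGap g B A
onGap g (outside ∷ B) (inside  ∷ A) = onGap (g ∘ suc) B A

onGap-cong : ∀ {f g : ℕ → ℕ} → (∀ k → f k ≡ g k) → ∀ (B A : Subset n) → onGap f B A ≡ onGap g B A
onGap-cong eq []            []            = eq 0
onGap-cong eq (inside  ∷ B) (outside ∷ A) = refl
onGap-cong eq (inside  ∷ B) (inside  ∷ A) = onGap-cong eq B A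
onGap-cong eq (outside ∷ B) (outside ∷ A) = onGap-cong eq B A
onGap-cong eq (outside ∷ B) (inside  ∷ A) = onGap-cong (eq ∘ suc) B A

onGap-+ : ∀ (f g : ℕ → ℕ) (B A : Subset n) →
          onGap (λ k → f k + g k) B A ≡ onGap f B A + onGap g B A
onGap-+ f g []            []            = refl
onGap-+ f g (inside  ∷ B) (outside ∷ A) = refl
onGap-+ f g (inside  ∷ B) (inside  ∷ A) = onGap-+ f g B A
onGap-+ f g (outside ∷ B) (outside ∷ A) = onGap-+ f g B A
onGap-+ f g (outside ∷ B) (inside  ∷ A) = onGap-+ (f ∘ suc) (g ∘ suc) B A

onGap-⊤ : ∀ (g : ℕ → ℕ) (B : Subset n) → onGap g B ⊤ ≡ g (n ∸ ∣ B ∣)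
onGap-⊤ g []            = refl
onGap-⊤ g (inside  ∷ B) = onGap-⊤ g B
onGap-⊤ {suc n} g (outside ∷ B) = trans (onGap-⊤ (g ∘ suc) B) (cong g (sym (+-∸-assoc 1 (∣p∣≤n B))))

-- A deletion from A keeps B inside exactly when the deleted element lies outside B; this leaves |A|
-- - |B| choices, each with the gap reduced by one. At gap 0 the factor k hides the default value of
-- `pred`.
deletions-onGap : ∀ (g : ℕ → ℕ) (B A : Subset n) →
                  deletions (onGap g B) A ≡ onGap (λ k → k * g (pred k)) B A
deletions-onGap g []            []            = refl
deletions-onGap g (inside  ∷ B) (outside ∷ A) = deletions-zero A
deletions-onGap g (inside  ∷ B) (inside  ∷ A) = deletions-onGap g B A
deletions-onGap g (outside ∷ B) (outside ∷ A) = deletions-onGap g B A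
deletions-onGap g (outside ∷ B) (inside  ∷ A) = begin
  onGap g B A + deletions (onGap (g ∘ suc) B) A
    ≡⟨ cong (onGap g B A +_) (deletions-onGap (g ∘ suc) B A) ⟩
  onGap g B A + onGap (λ k → k * g (suc (pred k))) B A
    ≡⟨ onGap-+ g _ B A ⟨
  onGap (λ k → g k + k * g (suc (pred k))) B A
    ≡⟨ onGap-cong (λ { zero → refl ; (suc k) → refl }) B A ⟩
  onGap (λ k → suc k * g k) B A ∎
  where open ≡-Reasoning

-- Each case determines `onGap g` for every g, so one view serves both `δ₀` and `!⁺`. The case
-- `proper` also yields the strict inclusion and the size relation from which forbidden
-- configurations are built.
data GapView {n} (B A : Subset n) : Set where
  not⊆   : (∀ g → onGap g B A ≡ 0) → GapView B A
  equal  : B ≡ A → (∀ g → onGap g B A ≡ g 0) → GapView B A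
  proper : ∀ k → B ⊂ A → ∣ A ∣ ≡ ∣ B ∣ + suc k → (∀ g → onGap g B A ≡ g (suc k)) → GapView B A

gapView : (B A : Subset n) → GapView B A
gapView []            []            = equal refl (λ _ → refl)
gapView (inside  ∷ B) (outside ∷ A) = not⊆ (λ _ → refl)
gapView (inside  ∷ B) (inside  ∷ A) with gapView B A
... | not⊆ z            = not⊆ z
... | equal refl v     = equal refl v
... | proper k B⊂A eq v = proper k (s⊂s B⊂A) (cong suc eq) v
gapView (outside ∷ B) (outside ∷ A) with gapView B A
... | not⊆ z            = not⊆ z
... | equal refl v     = equal refl v
... | proper k B⊂A eq v = proper k (s⊂s B⊂A) eq v
gapView (outside ∷ B) (inside  ∷ A) with gapView B A
... | not⊆ z            = not⊆ (λ g → z (g ∘ suc))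
... | equal refl v     = proper 0 (out⊂in (λ x → x)) (+-comm 1 _) (λ g → v (g ∘ suc))
... | proper k B⊂A eq v = proper (suc k) (out⊂in (proj₁ B⊂A)) (trans (cong suc eq) (sym (+-suc _ _)))
                           (λ g → v (g ∘ suc))

δ₀ : ℕ → ℕ
δ₀ zero    = 1
δ₀ (suc _) = 0

-- This is k! for positive k but 0 at k = 0, so that only strict inclusions are counted.
!⁺ : ℕ → ℕ
!⁺ k = k * pred k !

-- The number of ways to get from A down to B by deleting elements one at a time.
paths : Subset n → Subset n → ℕ
paths = onGap _!

-- The Kronecker delta of two sets, written through the gap so that `paths-rec` becomes an identity
-- between functions of k.
[_≈_] : Subset n → Subset n → ℕ
[_≈_] = onGap δ₀

[≈]-subst : ∀ (c : Subset n → ℕ) B A → c B * [ B ≈ A ] ≡ c A * [ B ≈ A ]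
[≈]-subst c B A with gapView B A
... | not⊆ z          rewrite z δ₀ = trans (*-zeroʳ (c B)) (sym (*-zeroʳ (c A)))
... | equal refl _   = refl
... | proper k _ _ v  rewrite v δ₀ = trans (*-zeroʳ (c B)) (sym (*-zeroʳ (c A)))

-- A way down from A to B is empty if A is B, and otherwise starts with one deletion. On gaps this
-- reads k! = `δ₀` k + `!⁺` k.
paths-rec : ∀ (B A : Subset n) → paths B A ≡ [ B ≈ A ] + deletions (paths B) A
paths-rec B A = begin
  onGap _! B A                       ≡⟨ onGap-cong (λ { zero → refl ; (suc k) → refl }) B A ⟩
  onGap (λ k → δ₀ k + !⁺ k) B A      ≡⟨ onGap-+ δ₀ !⁺ B A ⟩
  [ B ≈ A ] + onGap !⁺ B A           ≡⟨ cong ([ B ≈ A ] +_) (deletions-onGap _! B A) ⟨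
  [ B ≈ A ] + deletions (paths B) A  ∎
  where open ≡-Reasoning

∑[≈]≤1 : ∀ {F : List (Subset n)} → Unique F → ∀ A → ∑ F [_≈ A ] ≤ 1
∑[≈]≤1 []                 A = z≤n
∑[≈]≤1 {F = B ∷ F} (B∉ ∷ u) A with gapView B A
... | not⊆ z         rewrite z δ₀ = ∑[≈]≤1 u A
... | proper k _ _ v rewrite v δ₀ = ∑[≈]≤1 u A
... | equal refl v  rewrite v δ₀ = s≤s (≤-reflexive (absent F B∉))
  where
  absent : ∀ F → All (B ≢_) F → ∑ F [_≈ B ] ≡ 0
  absent []      []        = refl
  absent (D ∷ F) (B≢D ∷ a) with gapView D B
  ... | not⊆ z         rewrite z δ₀ = absent F a
  ... | proper k _ _ w rewrite w δ₀ = absent F a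
  ... | equal eq _    = contradiction (sym eq) B≢D

-- Counting maximal chains that meet a family

module Chains {n} (F : List (Subset n)) (F! : Unique F) where

  multiplicity : Subset n → ℕ
  multiplicity A = ∑ F [_≈ A ]

  -- Incidences between members of F and maximal chains of subsets of A.
  hits : Subset n → ℕ
  hits A = ∑ F (λ X → ∣ X ∣ ! * paths X A)

  -- The same count for pairs X ⊂ Y of members of F.
  pairHits : Subset n → ℕ
  pairHits A = ∑ F (λ Y → deletions hits Y * paths Y A)

  -- Both `hits` and `pairHits` sum some c against `paths`, so their recursion is proved once. By
  -- `paths-rec` either X is A, and c X becomes c A, or the path passes through a deletion of A.
  weighted-rec : ∀ (c : Subset n → ℕ) A → let S = λ B → ∑ F (λ X → c X * paths X B) in
                 S A ≡ c A * multiplicity A + deletions S A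
  weighted-rec c A = begin
    ∑ F (λ X → c X * paths X A)
      ≡⟨ ∑-cong F (λ X → trans (cong (c X *_) (paths-rec X A)) (*-distribˡ-+ (c X) _ _)) ⟩
    ∑ F (λ X → c X * [ X ≈ A ] + c X * deletions (paths X) A)
      ≡⟨ ∑-+ F _ _ ⟩
    ∑ F (λ X → c X * [ X ≈ A ]) + ∑ F (λ X → c X * deletions (paths X) A)
      ≡⟨ cong₂ _+_ (trans (∑-cong F (λ X → [≈]-subst c X A)) (∑-*ˡ F (c A) _))
                   (trans (∑-cong F (λ X → sym (deletions-*ˡ (c X) (paths X) A)))
                          (sym (deletions-∑ F (λ X B → c X * paths X B) A))) ⟩
    c A * multiplicity A + deletions (λ B → ∑ F (λ X → c X * paths X B)) A ∎
    where open ≡-Reasoning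

  hits-rec : ∀ A → hits A ≡ ∣ A ∣ ! * multiplicity A + deletions hits A
  hits-rec = weighted-rec (λ X → ∣ X ∣ !)

  pairHits-rec : ∀ A → pairHits A ≡ deletions hits A * multiplicity A + deletions pairHits A
  pairHits-rec = weighted-rec (deletions hits)

  -- A chain with h members of F contains at least h - 1 pairs.
  hits≤!+pairHits : ∀ k A → ∣ A ∣ ≡ k → hits A ≤ ∣ A ∣ ! + pairHits A
  hits≤!+pairHits k A ∣A∣≡k with multiplicity A | ∑[≈]≤1 F! A | hits-rec A | pairHits-rec A
  -- Here A is in F: every incidence strictly below A forms a pair with A, which `pairHits` counts.
  ... | 1 | s≤s z≤n | h | p = begin
    hits A                          ≡⟨ h ⟩
    ∣ A ∣ ! * 1 + deletions hits A
      ≡⟨ cong₂ _+_ (*-identityʳ (∣ A ∣ !)) (sym (*-identityʳ (deletions hits A))) ⟩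
    ∣ A ∣ ! + deletions hits A * 1  ≤⟨ +-monoʳ-≤ (∣ A ∣ !) (≤-trans (m≤m+n _ _) (≤-reflexive (sym p))) ⟩
    ∣ A ∣ ! + pairHits A            ∎
    where open ≤-Reasoning
  -- Here A is not in F: the bounds for its deletions add up.
  ... | 0 | _ | h | p = begin
    hits A                                               ≡⟨ h ⟩
    ∣ A ∣ ! * 0 + deletions hits A                       ≡⟨ cong (_+ deletions hits A) (*-zeroʳ (∣ A ∣ !)) ⟩
    deletions hits A                                     ≤⟨ below k ∣A∣≡k ⟩
    deletions (λ B → ∣ B ∣ ! + pairHits B) A             ≡⟨ deletions-+ _ pairHits A ⟩
    deletions (λ B → ∣ B ∣ !) A + deletions pairHits A   ≤⟨ +-mono-≤ (deletions-! A) (m≤n+m _ _) ⟩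
    ∣ A ∣ ! + (deletions hits A * 0 + deletions pairHits A) ≡⟨ cong (∣ A ∣ ! +_) p ⟨
    ∣ A ∣ ! + pairHits A                                 ∎
    where
    open ≤-Reasoning
    -- The recursion runs on the size `k`, since the sets B are not subterms of A.
    below : ∀ k → ∣ A ∣ ≡ k → deletions hits A ≤ deletions (λ B → ∣ B ∣ ! + pairHits B) A
    below k eq = deletions-mono A (λ B eq′ → rec k B (trans eq′ eq))
      where
      rec : ∀ k B → suc ∣ B ∣ ≡ k → hits B ≤ ∣ B ∣ ! + pairHits B
      rec (suc k) B refl = hits≤!+pairHits k B refl

  -- A maximal chain of subsets of A has only |A| + 1 members. This crude count suffices for the
  -- sizes far from n/2.
  hits-≤ : ∀ k A → ∣ A ∣ ≡ k → hits A ≤ suc ∣ A ∣ * ∣ A ∣ !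
  hits-≤ k A ∣A∣≡k = begin
    hits A                                         ≡⟨ hits-rec A ⟩
    ∣ A ∣ ! * multiplicity A + deletions hits A    ≤⟨ +-mono-≤ (*-monoʳ-≤ (∣ A ∣ !) (∑[≈]≤1 F! A))
                                                       (deletions-mono A (λ B eq → rec k B (trans eq ∣A∣≡k))) ⟩
    ∣ A ∣ ! * 1 + deletions (λ B → suc ∣ B ∣ * ∣ B ∣ !) A
      ≡⟨ cong₂ _+_ (*-identityʳ _) (deletions-size (λ a → suc a * a !) A) ⟩
    ∣ A ∣ ! + ∣ A ∣ * (suc (pred ∣ A ∣) * pred ∣ A ∣ !)   ≡⟨ cong (∣ A ∣ ! +_) (fold ∣ A ∣) ⟩
    suc ∣ A ∣ * ∣ A ∣ !                            ∎
    where
    open ≤-Reasoning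
    fold : ∀ a → a * (suc (pred a) * pred a !) ≡ a * a !
    fold zero    = refl
    fold (suc a) = refl
    rec : ∀ k B → suc ∣ B ∣ ≡ k → hits B ≤ suc ∣ B ∣ * ∣ B ∣ !
    rec (suc k) B refl = hits-≤ k B refl

  weight : Subset n → ℕ
  weight X = ∣ X ∣ ! * (n ∸ ∣ X ∣) !

  hits-⊤ : hits ⊤ ≡ ∑ F weight
  hits-⊤ = ∑-cong F (λ X → cong (∣ X ∣ ! *_) (onGap-⊤ _! X))

  -- Times |X|!, this counts the incidences of maximal chains with pairs X ⊂ Y: there are |X|! ways
  -- below X, (|Y| - |X|)! between and (n - |Y|)! above Y.
  supersets : Subset n → ℕ
  supersets X = ∑ F (λ Y → onGap !⁺ X Y * (n ∸ ∣ Y ∣) !)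

  -- Exchanging the sums groups the pairs by their lower member, as the hypothesis on F limits the
  -- supersets of one fixed set.
  pairHits-⊤ : pairHits ⊤ ≡ ∑ F (λ X → ∣ X ∣ ! * supersets X)
  pairHits-⊤ = begin
    ∑ F (λ Y → deletions hits Y * paths Y ⊤)
      ≡⟨ ∑-cong F (λ Y → cong₂ _*_ (expand Y) (onGap-⊤ _! Y)) ⟩
    ∑ F (λ Y → ∑ F (λ X → ∣ X ∣ ! * onGap !⁺ X Y) * (n ∸ ∣ Y ∣) !)
      ≡⟨ ∑-cong F (λ Y → trans (*-comm (∑ F (λ X → ∣ X ∣ ! * onGap !⁺ X Y)) ((n ∸ ∣ Y ∣) !))
                                  (sym (∑-*ˡ F ((n ∸ ∣ Y ∣) !) (λ X → ∣ X ∣ ! * onGap !⁺ X Y)))) ⟩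
    ∑ F (λ Y → ∑ F (λ X → (n ∸ ∣ Y ∣) ! * (∣ X ∣ ! * onGap !⁺ X Y)))
      ≡⟨ ∑-swap F F _ ⟩
    ∑ F (λ X → ∑ F (λ Y → (n ∸ ∣ Y ∣) ! * (∣ X ∣ ! * onGap !⁺ X Y)))
      ≡⟨ ∑-cong F (λ X → trans (∑-cong F (λ Y → rearrange ((n ∸ ∣ Y ∣) !) (∣ X ∣ !) (onGap !⁺ X Y))) (∑-*ˡ F (∣ X ∣ !) _)) ⟩
    ∑ F (λ X → ∣ X ∣ ! * supersets X) ∎
    where
    open ≡-Reasoning
    rearrange : ∀ a b c → a * (b * c) ≡ b * (c * a)
    rearrange = solve-∀
    expand : ∀ Y → deletions hits Y ≡ ∑ F (λ X → ∣ X ∣ ! * onGap !⁺ X Y)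
    expand Y = trans (deletions-∑ F _ Y)
      (∑-cong F (λ X → trans (deletions-*ˡ (∣ X ∣ !) (paths X) Y) (cong (∣ X ∣ ! *_) (deletions-onGap _! X Y))))

  -- For an antichain the pair term vanishes and this is the LYM inequality.
  lym-with-pairs : ∑ F weight ≤ n ! + ∑ F (λ X → ∣ X ∣ ! * supersets X)
  lym-with-pairs = subst₂ _≤_ hits-⊤ (cong₂ (λ a b → a ! + b) (∣⊤∣≡n n) pairHits-⊤)
                     (hits≤!+pairHits n ⊤ (∣⊤∣≡n n))

  lym-crude : ∑ F weight ≤ suc n * n !
  lym-crude = subst₂ _≤_ hits-⊤ (cong (λ a → suc a * a !) (∣⊤∣≡n n)) (hits-≤ n ⊤ (∣⊤∣≡n n))

-- Supersets of a member, level by level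

∑₁ : (ℕ → ℕ) → ℕ → ℕ
∑₁ h zero    = 0
∑₁ h (suc J) = h (suc J) + ∑₁ h J

∑₁-term : ∀ (h : ℕ → ℕ) {J k} → k < J → h (suc k) ≤ ∑₁ h J
∑₁-term h {suc J} {k} (s≤s k≤J) with k ≟ J
... | yes refl = m≤m+n _ _
... | no  k≢J  = ≤-trans (∑₁-term h (≤∧≢⇒< k≤J k≢J)) (m≤n+m _ _)

∑-∑₁-≤ : ∀ (xs : List A) (f : A → ℕ → ℕ) (h : ℕ → ℕ) r →
         (∀ k → ∑ xs (λ x → f x k) ≤ r * h k) →
         ∀ J → ∑ xs (λ x → ∑₁ (f x) J) ≤ r * ∑₁ h J
∑-∑₁-≤ xs f h r le zero    = ≤-trans (≤-reflexive (∑-zero xs)) z≤n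
∑-∑₁-≤ xs f h r le (suc J) = begin
  ∑ xs (λ x → f x (suc J) + ∑₁ (f x) J)               ≡⟨ ∑-+ xs _ _ ⟩
  ∑ xs (λ x → f x (suc J)) + ∑ xs (λ x → ∑₁ (f x) J)  ≤⟨ +-mono-≤ (le (suc J)) (∑-∑₁-≤ xs f h r le J) ⟩
  r * h (suc J) + r * ∑₁ h J                          ≡⟨ *-distribˡ-+ r _ _ ⟨
  r * (h (suc J) + ∑₁ h J)                            ∎
  where open ≤-Reasoning

indicator : ∀ {P : Set} → Dec P → ℕ
indicator (yes _) = 1
indicator (no  _) = 0

indicator-yes : ∀ {P : Set} (P? : Dec P) → P → indicator P? ≡ 1
indicator-yes (yes _) _ = refl
indicator-yes (no ¬p) p = contradiction p ¬p

∑-indicator : ∀ {P : Pred A 0ℓ} (P? : Decidable P) xs → ∑ xs (indicator ∘ P?) ≡ length (filter P? xs)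
∑-indicator P? []       = refl
∑-indicator P? (x ∷ xs) with P? x
... | yes _ = cong suc (∑-indicator P? xs)
... | no  _ = ∑-indicator P? xs

module Levels {n} (F : List (Subset n)) (F! : Unique F) (r : ℕ) (noConfig : ¬ HasConfig (suc r) n F) where
  open Chains F F!

  Above : Subset n → ℕ → Pred (Subset n) 0ℓ
  Above X k Y = ∣ Y ∣ ≡ ∣ X ∣ + k × X ⊂ Y

  above? : ∀ X k → Decidable (Above X k)
  above? X k Y = (∣ Y ∣ ≟ ∣ X ∣ + k) ×-dec (X ⊂? Y)

  -- Here r stands for s - 1. Any r + 1 members of F on one level above X would form the forbidden
  -- configuration with X; they are distinct because filtering keeps the list duplicate-free.
  few-above : ∀ {X} → X ∈ F → ∀ k → length (filter (above? X k) F) ≤ r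
  few-above {X} X∈F k with length (filter (above? X k) F) ≤? r
  ... | yes le = le
  ... | no ¬le = contradiction config noConfig
    where
    G = filter (above? X k) F
    pick : Fin (suc r) → Fin (length G)
    pick i = inject≤ i (≰⇒> ¬le)
    member : Fin (suc r) → Subset n
    member = lookup G ∘ pick
    member∈ : ∀ i → member i ∈ F × Above X k (member i)
    member∈ i = ∈-filter⁻ (above? X k) (∈-lookup (pick i))
    config : HasConfig (suc r) n F
    config = X , member , X∈F , proj₁ ∘ member∈
           , (λ eq → inject≤-injective _ _ _ _ (lookup-injective (filter⁺ (above? X k) F!) eq))
           , (λ i → proj₂ (proj₂ (member∈ i)))
           , λ i j → trans (proj₁ (proj₂ (member∈ i))) (sym (proj₁ (proj₂ (member∈ j))))

  -- All proper supersets of X in F lie on the levels 1 to J above X. Sets on one level contribute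
  -- equally, and there are at most r of them.
  supersets-≤ : ∀ J → (∀ {X Y} → X ∈ F → Y ∈ F → ∣ Y ∣ ≤ ∣ X ∣ + J) → ∀ {X} → X ∈ F →
                supersets X ≤ r * ∑₁ (λ k → k ! * (n ∸ ∣ X ∣ ∸ k) !) J
  supersets-≤ J spread {X} X∈F = ≤-trans (∑-mono F term) (∑-∑₁-≤ F f h r level J)
    where
    open ≤-Reasoning
    h : ℕ → ℕ
    h k = k ! * (n ∸ ∣ X ∣ ∸ k) !
    f : Subset n → ℕ → ℕ
    f Y k = indicator (above? X k Y) * h k
    level : ∀ k → ∑ F (λ Y → f Y k) ≤ r * h k
    level k = begin
      ∑ F (λ Y → f Y k)                          ≡⟨ ∑-cong F (λ Y → *-comm _ (h k)) ⟩
      ∑ F (λ Y → h k * indicator (above? X k Y)) ≡⟨ ∑-*ˡ F (h k) _ ⟩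
      h k * ∑ F (indicator ∘ above? X k)         ≡⟨ cong (h k *_) (∑-indicator (above? X k) F) ⟩
      h k * length (filter (above? X k) F)       ≤⟨ *-monoʳ-≤ (h k) (few-above X∈F k) ⟩
      h k * r                                    ≡⟨ *-comm (h k) r ⟩
      r * h k                                    ∎
    term : ∀ {Y} → Y ∈ F → onGap !⁺ X Y * (n ∸ ∣ Y ∣) ! ≤ ∑₁ (f Y) J
    term {Y} Y∈F with gapView X Y
    ... | not⊆ z          rewrite z !⁺ = z≤n
    ... | equal _ v      rewrite v !⁺ = z≤n
    ... | proper k X⊂Y eq v = begin
      onGap !⁺ X Y * (n ∸ ∣ Y ∣) !           ≡⟨ cong₂ (λ a b → a * b !) (v !⁺)
                                                  (trans (cong (n ∸_) eq) (sym (∸-+-assoc n ∣ X ∣ (suc k)))) ⟩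
      h (suc k)                              ≡⟨ *-identityˡ _ ⟨
      1 * h (suc k)
        ≡⟨ cong (_* h (suc k)) (indicator-yes (above? X (suc k) Y) (eq , X⊂Y)) ⟨
      f Y (suc k)
        ≤⟨ ∑₁-term (f Y) (+-cancelˡ-≤ ∣ X ∣ _ _ (≤-trans (≤-reflexive (sym eq)) (spread X∈F Y∈F))) ⟩
      ∑₁ (f Y) J                             ∎

open ≤-Reasoning

-- Estimates for products of factorials

≤-offset : ∀ {a b} k → a + k ≡ b → a ≤ b
≤-offset {a} k eq = ≤-trans (m≤m+n a k) (≤-reflexive eq)

C*k!*[n∸k]!≡n! : ∀ {n k} → k ≤ n → (n C k) * (k ! * (n ∸ k) !) ≡ n !
C*k!*[n∸k]!≡n! {n} {k} k≤n =
  trans (cong (_* (k ! * (n ∸ k) !)) (nCk≡n!/k![n-k]! k≤n))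
        (m/n*n≡m (k![n∸k]!∣n! k≤n))
  where instance _ = k !* (n ∸ k) !≢0

-- One step multiplies the product by (b + e + 1) / (a + 1) ≥ 1 + (2e + 1) / p, and
-- the increments 2e + 1 add up to a square.
!*!-growth : ∀ e a b p → a + e ≤ b → a + e ≤ p →
             (a + e) ! * b ! * (p + e * e) ≤ a ! * (b + e) ! * p
!*!-growth zero    a b p _ _ rewrite +-identityʳ a | +-identityʳ b | +-identityʳ p = ≤-refl
!*!-growth (suc e) a b p a+e≤b a+e≤p rewrite +-suc a e | +-suc b e = begin
  H * (p + suc e * suc e)                        ≡⟨ square H p e ⟩
  H * (p + e * e) + H * (2 * e + 1)              ≤⟨ +-mono-≤ ih (*-monoˡ-≤ (2 * e + 1) H≤Zp) ⟩
  suc a * a ! * (b + e) ! * p + a ! * (b + e) ! * p * (2 * e + 1)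
                                                 ≡⟨ collect a (a !) ((b + e) !) p e ⟩
  a ! * ((a + e + 1 + e + 1) * (b + e) !) * p
    ≤⟨ *-monoˡ-≤ p (*-monoʳ-≤ (a !) (*-monoˡ-≤ ((b + e) !) step)) ⟩
  a ! * (suc (b + e) * (b + e) !) * p            ∎
  where
  H = suc (a + e) ! * b !
  ih : H * (p + e * e) ≤ suc a ! * (b + e) ! * p
  ih = !*!-growth e (suc a) b p a+e≤b a+e≤p
  instance
    p≢0 : NonZero p
    p≢0 = >-nonZero (≤-trans (s≤s z≤n) a+e≤p)
  rotate : ∀ a x y → suc a * x * y ≡ x * y * suc a
  rotate = solve-∀
  -- The increment 2 e + 1 comes multiplied by H. Dropping the gain e² from `ih` and using a + 1 ≤ p
  -- brings it to the form of the target.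
  H≤Zp : H ≤ a ! * (b + e) ! * p
  H≤Zp = begin
    H                        ≤⟨ *-cancelʳ-≤ H _ p (≤-trans (*-monoʳ-≤ H (m≤m+n p (e * e))) ih) ⟩
    suc a ! * (b + e) !      ≡⟨ rotate a (a !) ((b + e) !) ⟩
    a ! * (b + e) ! * suc a  ≤⟨ *-monoʳ-≤ (a ! * (b + e) !) (≤-trans (s≤s (m≤m+n a e)) a+e≤p) ⟩
    a ! * (b + e) ! * p      ∎
  square : ∀ H p e → H * (p + suc e * suc e) ≡ H * (p + e * e) + H * (2 * e + 1)
  square = solve-∀
  collect : ∀ a x y p e → suc a * x * y * p + x * y * p * (2 * e + 1) ≡ x * ((a + e + 1 + e + 1) * y) * p
  collect = solve-∀
  -- As b is at least a + e + 1, the new factor b + e + 1 is at least (a + 1) + (2 e + 1).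
  step : a + e + 1 + e + 1 ≤ suc (b + e)
  step = begin
    a + e + 1 + e + 1    ≡⟨ shape a e ⟩
    suc (suc (a + e) + e) ≤⟨ s≤s (+-monoˡ-≤ e a+e≤b) ⟩
    suc (b + e)          ∎
    where
    shape : ∀ a e → a + e + 1 + e + 1 ≡ suc (suc (a + e) + e)
    shape = solve-∀

-- This is `!*!-growth` for p = a + e with the gain dropped; p can be cancelled only if positive,
-- hence the separate case 0.
!*!-mono : ∀ e a b → a + e ≤ b → (a + e) ! * b ! ≤ a ! * (b + e) !
!*!-mono e a b le with a + e in eq
... | zero rewrite m+n≡0⇒m≡0 a eq | m+n≡0⇒n≡0 a eq | +-identityʳ b = ≤-refl
... | suc p = *-cancelʳ-≤ _ _ (suc p) (≤-trans (*-monoʳ-≤ (suc p ! * b !) (m≤m+n (suc p) (e * e)))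
  (subst (λ x → x ! * b ! * (suc p + e * e) ≤ a ! * (b + e) ! * suc p) eq
    (!*!-growth e a b (suc p) (≤-trans (≤-reflexive eq) le) (≤-reflexive eq))))

-- Each of three shifts by e gains a factor (p + e²) / p, at least e² / p. With e of order p the
-- total is of order p³: one power outweighs the n + 1 of `lym-crude`, two remain for the error.
!*!-growth³ : ∀ e a q → let p = a + e + e + e in p ≤ q →
              p ! * q ! * ((e * e) * (e * e) * (e * e)) ≤ a ! * (q + e + e + e) ! * (p * p * p)
!*!-growth³ e a q p≤q = begin
  W₀ * ((e * e) * (e * e) * (e * e)) ≤⟨ *-monoʳ-≤ W₀ (*-mono-≤ (*-mono-≤ e²≤ e²≤) e²≤) ⟩
  W₀ * (E * E * E)                   ≡⟨ assoc₁ W₀ E ⟩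
  W₀ * E * E * E                     ≤⟨ *-monoˡ-≤ E (*-monoˡ-≤ E g₁) ⟩
  W₁ * p * E * E                     ≡⟨ assoc₂ W₁ E p ⟩
  W₁ * E * E * p                     ≤⟨ *-monoˡ-≤ p (*-monoˡ-≤ E g₂) ⟩
  W₂ * p * E * p                     ≡⟨ assoc₃ W₂ E p ⟩
  W₂ * E * (p * p)                   ≤⟨ *-monoˡ-≤ (p * p) g₃ ⟩
  W₃ * p * (p * p)                   ≡⟨ assoc₄ W₃ p ⟩
  W₃ * (p * p * p)                   ∎
  where
  p  = a + e + e + e
  E  = p + e * e
  W₀ = p ! * q !
  W₁ = (a + e + e) ! * (q + e) !
  W₂ = (a + e) ! * (q + e + e) !
  W₃ = a ! * (q + e + e + e) !
  e²≤ : e * e ≤ E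
  e²≤ = m≤n+m (e * e) p
  g₁ : W₀ * E ≤ W₁ * p
  g₁ = !*!-growth e (a + e + e) q p p≤q ≤-refl
  g₂ : W₁ * E ≤ W₂ * p
  g₂ = !*!-growth e (a + e) (q + e) p (≤-trans (m≤m+n _ e) (≤-trans p≤q (m≤m+n q e))) (m≤m+n _ e)
  g₃ : W₂ * E ≤ W₃ * p
  g₃ = !*!-growth e a (q + e + e) p
         (≤-trans (m≤m+n _ e) (≤-trans (m≤m+n _ e) (≤-trans p≤q (≤-trans (m≤m+n q e) (m≤m+n _ e)))))
         (≤-trans (m≤m+n _ e) (m≤m+n _ e))
  assoc₁ : ∀ W E → W * (E * E * E) ≡ W * E * E * E
  assoc₁ = solve-∀
  assoc₂ : ∀ W E p → W * p * E * E ≡ W * E * E * p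
  assoc₂ = solve-∀
  assoc₃ : ∀ W E p → W * p * E * p ≡ W * E * (p * p)
  assoc₃ = solve-∀
  assoc₄ : ∀ W p → W * p * (p * p) ≡ W * (p * p * p)
  assoc₄ = solve-∀

-- From the second term on the sum is dominated by a geometric series of ratio 1/2.
∑₁-halving : ∀ (h : ℕ → ℕ) J → (∀ k → 2 ≤ k → k < J → 2 * h (suc k) ≤ h k) → ∑₁ h J ≤ h 1 + 2 * h 2
∑₁-halving h 0             half = z≤n
∑₁-halving h 1             half = +-monoʳ-≤ (h 1) z≤n
∑₁-halving h (suc (suc J)) half = ≤-trans (m≤m+n _ (h (suc (suc J)))) (strong J half)
  where
  -- Counting the last term twice makes the induction close: the double of the next term is at most
  -- that extra copy.
  strong : ∀ J → (∀ k → 2 ≤ k → k < 2 + J → 2 * h (suc k) ≤ h k) →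
           ∑₁ h (2 + J) + h (2 + J) ≤ h 1 + 2 * h 2
  strong zero half = ≤-reflexive (shape (h 1) (h 2))
    where
    shape : ∀ a b → b + (a + 0) + b ≡ a + 2 * b
    shape = solve-∀
  strong (suc J) half = begin
    h (3 + J) + ∑₁ h (2 + J) + h (3 + J)  ≡⟨ shape (h (3 + J)) (∑₁ h (2 + J)) ⟩
    ∑₁ h (2 + J) + 2 * h (3 + J)          ≤⟨ +-monoʳ-≤ (∑₁ h (2 + J)) (half (2 + J) (s≤s (s≤s z≤n)) ≤-refl) ⟩
    ∑₁ h (2 + J) + h (2 + J)              ≤⟨ strong J (λ k 2≤k k< → half k 2≤k (m≤n⇒m≤1+n k<)) ⟩
    h 1 + 2 * h 2                         ∎
    where
    shape : ∀ a b → a + b + a ≡ b + 2 * a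
    shape = solve-∀

!*!-halving : ∀ k l → 2 * suc k ≤ suc l → 2 * (suc k ! * l !) ≤ k ! * suc l !
!*!-halving k l le = begin
  2 * (suc k * k ! * l !)    ≡⟨ left (suc k) (k !) (l !) ⟩
  k ! * ((2 * suc k) * l !)  ≤⟨ *-monoʳ-≤ (k !) (*-monoˡ-≤ (l !) le) ⟩
  k ! * (suc l * l !)        ∎
  where
  left : ∀ s x y → 2 * (s * x * y) ≡ x * ((2 * s) * y)
  left = solve-∀

-- With m = l + 2, the first term is (l + 1) l! and twice the second is 4 l!. Relative to m! this is
-- 1/m + O(1/m²). The terms halve as long as 3 k ≤ l, which the bound on J ensures.
∑₁-!*! : ∀ l J → 3 * J ≤ 3 + l → ∑₁ (λ k → k ! * (2 + l ∸ k) !) J ≤ (l + 5) * l !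
∑₁-!*! l J 3J≤ = ≤-trans (∑₁-halving h J half) (≤-reflexive (ends l (l !)))
  where
  h : ℕ → ℕ
  h k = k ! * (2 + l ∸ k) !
  ends : ∀ l x → 1 * ((1 + l) * x) + 2 * (2 * x) ≡ (l + 5) * x
  ends = solve-∀
  half : ∀ k → 2 ≤ k → k < J → 2 * h (suc k) ≤ h k
  half k _ k<J = subst (λ x → 2 * (suc k ! * (1 + l ∸ k) !) ≤ k ! * x !) (sym slack)
                   (!*!-halving k (1 + l ∸ k) (subst (2 * suc k ≤_) slack (m+n≤o⇒m≤o∸n (2 * suc k) room)))
    where
    shape : ∀ k → suc (2 * suc k + k) ≡ 3 * suc k
    shape = solve-∀
    room : 2 * suc k + k ≤ 2 + l
    room = s≤s⁻¹ (≤-trans (≤-reflexive (shape k)) (≤-trans (*-monoʳ-≤ 3 k<J) 3J≤))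
    slack : 2 + l ∸ k ≡ 1 + (1 + l ∸ k)
    slack = +-∸-assoc 1 (s≤s⁻¹ (≤-trans (+-monoˡ-≤ k (m≤m+n 1 (k + (1 + (k + 0))))) room))

-- Numerical inequalities behind the main and error terms

-- In fractions: (l + 5) / ((l + 2) (l + 1)) is at most 2/n + (12 d + 72) / n². The bound n ≤ 2 m +
-- 2 d + 1 produces the leading term, and n ≤ 3 m turns the rest into multiples of m.
gap-ratio : ∀ n l d → n ≤ 2 * (2 + l) + 2 * d + 1 → n ≤ 3 * (2 + l) →
            n * n * (l + 5) ≤ (2 + l) * (1 + l) * (2 * n + 12 * d + 72)
gap-ratio n l d n≤2m n≤3m = begin
  n * n * (l + 5)                                     ≡⟨ split n l ⟩
  n * n * m + 3 * (n * n)
    ≤⟨ +-mono-≤ (*-monoˡ-≤ m (*-monoʳ-≤ n n≤2m)) (*-monoʳ-≤ 3 (*-mono-≤ n≤3m n≤3m)) ⟩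
  n * (2 * m + 2 * d + 1) * m + 3 * (3 * m * (3 * m)) ≡⟨ regroup n m d ⟩
  m * (2 * n * m + n * (2 * d + 1) + 27 * m)
    ≤⟨ *-monoʳ-≤ m (+-monoˡ-≤ (27 * m) (+-monoʳ-≤ (2 * n * m) (*-monoˡ-≤ (2 * d + 1) n≤3m))) ⟩
  m * (2 * n * m + 3 * m * (2 * d + 1) + 27 * m)      ≡⟨ expand n l d ⟩
  m * (2 * n * (1 + l) + 2 * n + m * (6 * d + 30))
    ≤⟨ *-monoʳ-≤ m (+-monoˡ-≤ (m * (6 * d + 30)) (+-monoʳ-≤ (2 * n * (1 + l)) (*-monoʳ-≤ 2 n≤3m))) ⟩
  m * (2 * n * (1 + l) + 2 * (3 * m) + m * (6 * d + 30))
                                                      ≤⟨ ≤-offset (m * (l * (6 * d + 36))) (finish n l d) ⟩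
  m * (1 + l) * (2 * n + 12 * d + 72)                 ∎
  where
  m = 2 + l
  split : ∀ n l → n * n * (l + 5) ≡ n * n * (2 + l) + 3 * (n * n)
  split = solve-∀
  regroup : ∀ n m d → n * (2 * m + 2 * d + 1) * m + 3 * (3 * m * (3 * m)) ≡ m * (2 * n * m + n * (2 * d + 1) + 27 * m)
  regroup = solve-∀
  expand : ∀ n l d → (2 + l) * (2 * n * (2 + l) + 3 * (2 + l) * (2 * d + 1) + 27 * (2 + l))
                   ≡ (2 + l) * (2 * n * (1 + l) + 2 * n + (2 + l) * (6 * d + 30))
  expand = solve-∀
  finish : ∀ n l d → (2 + l) * (2 * n * (1 + l) + 2 * (3 * (2 + l)) + (2 + l) * (6 * d + 30)) + (2 + l) * (l * (6 * d + 36))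
                   ≡ (2 + l) * (1 + l) * (2 * n + 12 * d + 72)
  finish = solve-∀

-- The loss 12 d r against the average is paid for by the factor 1 + d² / p in W.
absorb-deviation : ∀ n r d p V W W₀ .{{_ : NonZero p}} → let Y = r * (2 * n + 12 * d + 72) in
  n * n * V ≤ W * Y → W₀ * (p + d * d) ≤ W * p → 2 * Y ≤ n * n → 24 * r * p ≤ n * n →
  n * n * V + n * n * W₀ ≤ n * n * W + W₀ * (2 * r * n + 72 * r)
absorb-deviation n r d p V W W₀ nnV≤ W₀≤ 2Y≤ 24rp≤ = from-excess W₀≤W
  where
  Y = r * (2 * n + 12 * d + 72)
  W₀≤W : W₀ ≤ W
  W₀≤W = *-cancelʳ-≤ W₀ W p (≤-trans (*-monoʳ-≤ W₀ (m≤m+n p (d * d))) W₀≤)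
  from-excess : W₀ ≤ W → n * n * V + n * n * W₀ ≤ n * n * W + W₀ * (2 * r * n + 72 * r)
  from-excess le with W ∸ W₀ | m+[n∸m]≡n le
  ... | δ | refl = begin
    n * n * V + n * n * W₀           ≤⟨ +-monoˡ-≤ (n * n * W₀) nnV≤ ⟩
    (W₀ + δ) * Y + n * n * W₀        ≡⟨ expand n r d W₀ δ ⟩
    δ * Y + 12 * r * d * W₀ + (n * n * W₀ + W₀ * (2 * r * n + 72 * r))
                                     ≤⟨ +-monoˡ-≤ (n * n * W₀ + W₀ * (2 * r * n + 72 * r)) halves ⟩
    n * n * δ + (n * n * W₀ + W₀ * (2 * r * n + 72 * r)) ≡⟨ collect n δ W₀ (W₀ * (2 * r * n + 72 * r)) ⟩
    n * n * (W₀ + δ) + W₀ * (2 * r * n + 72 * r) ∎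
    where
    expand : ∀ n r d W₀ δ → (W₀ + δ) * (r * (2 * n + 12 * d + 72)) + n * n * W₀
           ≡ δ * (r * (2 * n + 12 * d + 72)) + 12 * r * d * W₀ + (n * n * W₀ + W₀ * (2 * r * n + 72 * r))
    expand = solve-∀
    double : ∀ r d W₀ δ Y → 2 * (δ * Y + 12 * r * d * W₀) ≡ δ * (2 * Y) + 24 * r * (d * W₀)
    double = solve-∀
    twice : ∀ n δ → δ * (n * n) + n * n * δ ≡ 2 * (n * n * δ)
    twice = solve-∀
    collect : ∀ n δ W₀ z → n * n * δ + (n * n * W₀ + z) ≡ n * n * (W₀ + δ) + z
    collect = solve-∀
    excess : W₀ * (d * d) ≤ δ * p
    excess = +-cancelˡ-≤ (W₀ * p) _ _ (begin
      W₀ * p + W₀ * (d * d) ≡⟨ *-distribˡ-+ W₀ p (d * d) ⟨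
      W₀ * (p + d * d)      ≤⟨ W₀≤ ⟩
      (W₀ + δ) * p          ≡⟨ *-distribʳ-+ p W₀ δ ⟩
      W₀ * p + δ * p        ∎)
    d≤d*d : ∀ d → d ≤ d * d
    d≤d*d zero    = z≤n
    d≤d*d (suc d) = m≤m*n (suc d) (suc d)
    assoc₁ : ∀ r p d W₀ → 24 * r * (d * W₀) * p ≡ 24 * r * p * (W₀ * d)
    assoc₁ = solve-∀
    main : 24 * r * (d * W₀) ≤ n * n * δ
    main = *-cancelʳ-≤ _ _ p (begin
      24 * r * (d * W₀) * p      ≡⟨ assoc₁ r p d W₀ ⟩
      24 * r * p * (W₀ * d)      ≤⟨ *-mono-≤ 24rp≤ (*-monoʳ-≤ W₀ (d≤d*d d)) ⟩
      n * n * (W₀ * (d * d))     ≤⟨ *-monoʳ-≤ (n * n) excess ⟩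
      n * n * (δ * p)            ≡⟨ *-assoc (n * n) δ p ⟨
      n * n * δ * p              ∎)
    -- Each of the two errors takes half of n² δ: the first by 2 Y ≤ n², the second by `main`.
    halves : δ * Y + 12 * r * d * W₀ ≤ n * n * δ
    halves = *-cancelˡ-≤ 2 (begin
      2 * (δ * Y + 12 * r * d * W₀)    ≡⟨ double r d W₀ δ Y ⟩
      δ * (2 * Y) + 24 * r * (d * W₀)  ≤⟨ +-mono-≤ (*-monoʳ-≤ δ 2Y≤) main ⟩
      δ * (n * n) + n * n * δ          ≡⟨ twice n δ ⟩
      2 * (n * n * δ)                  ∎)

-- The unknown f also stands on the right, with a coefficient of at most n²/2. Absorbing it gives f
-- ≤ 2 B; inserting this gives n f ≤ (n + 148 r) B; inserting both gives the claim.
bootstrap : ∀ n r f B .{{_ : NonZero n}} → 172 * r ≤ n →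
            f * (n * n) ≤ n * n * B + f * (2 * r * n + 72 * r) →
            n * (n * f) ≤ n * ((n + 2 * r) * B) + (296 * (r * r) + 144 * r) * B
bootstrap n r f B 172r≤n le = begin
  n * (n * f)                                          ≡⟨ comm n f ⟩
  f * (n * n)                                          ≤⟨ le ⟩
  n * n * B + f * (2 * r * n + 72 * r)                 ≡⟨ split n r f B ⟩
  n * n * B + (2 * r * (n * f) + 72 * r * f)
    ≤⟨ +-monoʳ-≤ (n * n * B) (+-mono-≤ (*-monoʳ-≤ (2 * r) second) (*-monoʳ-≤ (72 * r) first)) ⟩
  n * n * B + (2 * r * ((n + 148 * r) * B) + 72 * r * (2 * B)) ≡⟨ collect n r B ⟩
  n * ((n + 2 * r) * B) + (296 * (r * r) + 144 * r) * B ∎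
  where
  comm : ∀ n f → n * (n * f) ≡ f * (n * n)
  comm = solve-∀
  split : ∀ n r f B → n * n * B + f * (2 * r * n + 72 * r) ≡ n * n * B + (2 * r * (n * f) + 72 * r * f)
  split = solve-∀
  collect : ∀ n r B → n * n * B + (2 * r * ((n + 148 * r) * B) + 72 * r * (2 * B))
          ≡ n * ((n + 2 * r) * B) + (296 * (r * r) + 144 * r) * B
  collect = solve-∀
  small : 2 * (2 * r * n + 72 * r) ≤ n * n
  small = begin
    2 * (2 * r * n + 72 * r)      ≤⟨ *-monoʳ-≤ 2 (+-monoʳ-≤ (2 * r * n) (m≤m*n (72 * r) n)) ⟩
    2 * (2 * r * n + 72 * r * n)  ≤⟨ ≤-offset (24 * r * n) (shape r n) ⟩
    172 * r * n                   ≤⟨ *-monoˡ-≤ n 172r≤n ⟩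
    n * n                         ∎
    where
    shape : ∀ r n → 2 * (2 * r * n + 72 * r * n) + 24 * r * n ≡ 172 * r * n
    shape = solve-∀
  instance
    n*n≢0 : NonZero (n * n)
    n*n≢0 = m*n≢0 n n
  first : f ≤ 2 * B
  first = *-cancelʳ-≤ f (2 * B) (n * n) (+-cancelʳ-≤ (f * (n * n)) _ _ (begin
    f * (n * n) + f * (n * n)              ≡⟨ double (f * (n * n)) ⟩
    2 * (f * (n * n))                      ≤⟨ *-monoʳ-≤ 2 le ⟩
    2 * (n * n * B + f * (2 * r * n + 72 * r)) ≡⟨ shape n B f (2 * r * n + 72 * r) ⟩
    2 * B * (n * n) + f * (2 * (2 * r * n + 72 * r)) ≤⟨ +-monoʳ-≤ (2 * B * (n * n)) (*-monoʳ-≤ f small) ⟩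
    2 * B * (n * n) + f * (n * n)          ∎))
    where
    double : ∀ x → x + x ≡ 2 * x
    double = solve-∀
    shape : ∀ n B f c → 2 * (n * n * B + f * c) ≡ 2 * B * (n * n) + f * (2 * c)
    shape = solve-∀
  second : n * f ≤ (n + 148 * r) * B
  second = *-cancelˡ-≤ n (begin
    n * (n * f)                                  ≡⟨ comm n f ⟩
    f * (n * n)                                  ≤⟨ le ⟩
    n * n * B + f * (2 * r * n + 72 * r)
      ≤⟨ +-monoʳ-≤ (n * n * B) (*-mono-≤ first (+-monoʳ-≤ (2 * r * n) (m≤m*n (72 * r) n))) ⟩
    n * n * B + 2 * B * (2 * r * n + 72 * r * n) ≡⟨ shape n r B ⟩
    n * ((n + 148 * r) * B)                      ∎)
    where
    shape : ∀ n r B → n * n * B + 2 * B * (2 * r * n + 72 * r * n) ≡ n * ((n + 148 * r) * B)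
    shape = solve-∀

-- Sizes near n/2 and sizes far from it

-- A size x and its complement size n - x, sorted as p - d and q + d.
data Split (n p q x : ℕ) : Set where
  low  : ∀ d → x + d ≡ p → n ∸ x ≡ q + d → Split n p q x
  high : ∀ d → q + d ≡ x → n ∸ x + d ≡ p → Split n p q x

split : ∀ {n p q} x → p + q ≡ n → q ≤ suc p → x ≤ n → Split n p q x
split {n} {p} {q} x refl q≤1+p x≤n with x ≤? p
... | yes x≤p = low (p ∸ x) (m+[n∸m]≡n x≤p) (trans (+-∸-comm q x≤p) (+-comm (p ∸ x) q))
... | no  x≰p = high (x ∸ q) (m+[n∸m]≡n q≤x) (begin-equality
    p + q ∸ x + (x ∸ q)      ≡⟨ +-∸-assoc (p + q ∸ x) q≤x ⟨
    (p + q ∸ x + x) ∸ q      ≡⟨ cong (_∸ q) (m∸n+n≡m x≤n) ⟩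
    p + q ∸ q                ≡⟨ m+n∸n≡m p q ⟩
    p                        ∎)
  where
  -- No size lies strictly between p and q.
  q≤x : q ≤ x
  q≤x = ≤-trans q≤1+p (≰⇒> x≰p)

-- Here p and q are n/2 rounded down and up. The middle sizes reach 3 e beyond them: 32 e ≤ p keeps
-- these sizes near n/2, and p ≤ 64 e makes the tail gain of order n³.
module Sizes (n p q e r : ℕ) (p+q≡n : p + q ≡ n) (p≤q : p ≤ q) (q≤1+p : q ≤ suc p)
             (1≤e : 1 ≤ e) (32e≤p : 32 * e ≤ p) (p≤64e : p ≤ 64 * e) (172r≤n : 172 * r ≤ n) where

  weight₀ : ℕ
  weight₀ = p ! * q !

  sizeWeight : ℕ → ℕ
  sizeWeight x = x ! * (n ∸ x) !

  Middle : Pred ℕ 0ℓ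
  Middle x = p ≤ x + 3 * e × x ≤ q + 3 * e

  middle? : Decidable Middle
  middle? x = (p ≤? x + 3 * e) ×-dec (x ≤? q + 3 * e)

  instance
    p≢0 : NonZero p
    p≢0 = >-nonZero (≤-trans (≤-trans 1≤e (m≤m+n e _)) 32e≤p)

  n≢0 : NonZero n
  n≢0 = >-nonZero (≤-trans (>-nonZero⁻¹ p) (≤-trans (m≤m+n p q) (≤-reflexive p+q≡n)))

  n≤2p+1 : n ≤ 2 * p + 1
  n≤2p+1 = begin
    n          ≡⟨ p+q≡n ⟨
    p + q      ≤⟨ +-monoʳ-≤ p q≤1+p ⟩
    p + suc p  ≡⟨ shape p ⟩
    2 * p + 1  ∎
    where
    shape : ∀ p → p + suc p ≡ 2 * p + 1
    shape = solve-∀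

  p≤n : p ≤ n
  p≤n = ≤-trans (m≤m+n p q) (≤-reflexive p+q≡n)

  3e≤p : 3 * e ≤ p
  3e≤p = ≤-trans (*-monoˡ-≤ e (m≤m+n 3 29)) 32e≤p

  -- Moving away from p, the first 3 e steps earn the factor e⁶ / p³ and the remaining ones lose
  -- nothing.
  tail-block : ∀ a j → a + (3 * e + suc j) ≡ p →
               weight₀ * (e * e * (e * e) * (e * e)) ≤ a ! * (q + (3 * e + suc j)) ! * (p * p * p)
  tail-block a j eq = begin
    weight₀ * e⁶                              ≡⟨ cong (λ x → x ! * q ! * e⁶) p≡ ⟨
    p′ ! * q ! * e⁶                           ≤⟨ !*!-growth³ e (a + suc j) q (≤-trans (≤-reflexive p≡) p≤q) ⟩
    (a + suc j) ! * (q + e + e + e) ! * (p′ * p′ * p′)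
      ≡⟨ cong (λ x → (a + suc j) ! * (q + e + e + e) ! * (x * x * x)) p≡ ⟩
    (a + suc j) ! * (q + e + e + e) ! * (p * p * p)
      ≤⟨ *-monoˡ-≤ (p * p * p) (!*!-mono (suc j) a (q + e + e + e) a+j≤) ⟩
    a ! * (q + e + e + e + suc j) ! * (p * p * p) ≡⟨ cong (λ x → a ! * x ! * (p * p * p)) (shape₂ q e j) ⟩
    a ! * (q + (3 * e + suc j)) ! * (p * p * p) ∎
    where
    e⁶ = e * e * (e * e) * (e * e)
    p′ = a + suc j + e + e + e
    shape₁ : ∀ a e j → a + suc j + e + e + e ≡ a + (3 * e + suc j)
    shape₁ = solve-∀
    shape₂ : ∀ q e j → q + e + e + e + suc j ≡ q + (3 * e + suc j)
    shape₂ = solve-∀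
    p≡ : p′ ≡ p
    p≡ = trans (shape₁ a e j) eq
    a+j≤ : a + suc j ≤ q + e + e + e
    a+j≤ = ≤-trans (≤-trans (m≤m+n _ (e + e + e)) (≤-trans (≤-reflexive (shape₃ a e j)) (≤-trans (≤-reflexive p≡) p≤q)))
                   (≤-trans (m≤m+n q (e + e + e)) (≤-reflexive (shape₄ q e)))
      where
      shape₃ : ∀ a e j → a + suc j + (e + e + e) ≡ a + suc j + e + e + e
      shape₃ = solve-∀
      shape₄ : ∀ q e → q + (e + e + e) ≡ q + e + e + e
      shape₄ = solve-∀

  tail-weight : ∀ {x} → x ≤ n → ¬ Middle x →
                weight₀ * (e * e * (e * e) * (e * e)) ≤ sizeWeight x * (p * p * p)
  tail-weight {x} x≤n ¬mid with split x p+q≡n q≤1+p x≤n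
  ... | low d x+d≡p n∸x≡ with d ≤? 3 * e
  ...   | yes d≤ = contradiction
            ( ≤-trans (≤-reflexive (sym x+d≡p)) (+-monoʳ-≤ x d≤)
            , ≤-trans (≤-trans (m≤m+n x d) (≤-trans (≤-reflexive x+d≡p) p≤q)) (m≤m+n q _)) ¬mid
  ...   | no d≰ with m≤n⇒∃[o]m+o≡n (≰⇒> d≰)
  ...     | j , refl rewrite n∸x≡ | sym (+-suc (3 * e) j) = tail-block x j x+d≡p
  tail-weight {x} x≤n ¬mid | high d q+d≡x n∸x+d≡p with d ≤? 3 * e
  ...   | yes d≤ = contradiction
            ( ≤-trans p≤q (≤-trans (m≤m+n q d) (≤-trans (≤-reflexive q+d≡x) (m≤m+n x _)))
            , ≤-trans (≤-reflexive (sym q+d≡x)) (+-monoʳ-≤ q d≤)) ¬mid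
  ...   | no d≰ with m≤n⇒∃[o]m+o≡n (≰⇒> d≰)
  ...     | j , refl rewrite sym (+-suc (3 * e) j) = begin
    weight₀ * (e * e * (e * e) * (e * e))            ≤⟨ tail-block (n ∸ x) j n∸x+d≡p ⟩
    (n ∸ x) ! * (q + (3 * e + suc j)) ! * (p * p * p) ≡⟨ cong (_* (p * p * p)) (*-comm ((n ∸ x) !) _) ⟩
    (q + (3 * e + suc j)) ! * (n ∸ x) ! * (p * p * p) ≡⟨ cong (λ y → y ! * (n ∸ x) ! * (p * p * p)) q+d≡x ⟩
    sizeWeight x * (p * p * p)                         ∎

  -- Cancelling `weight₀` leaves g e⁶ ≤ (n + 1) B p³. Then n + 1 ≤ 192 e and p ≤ 64 e turn n² (n +
  -- 1) p³ into a constant times e⁶.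
  tail-size : ∀ g B → B * weight₀ ≡ n ! → g * (weight₀ * (e * e * (e * e) * (e * e))) ≤ suc n * n ! * (p * p * p) →
              n * (n * g) ≤ 192 * 192 * 192 * (64 * 64 * 64) * B
  tail-size g B B*w≡n! le = *-cancelʳ-≤ _ _ e⁶ (begin
    n * (n * g) * e⁶                                     ≡⟨ pull n g e⁶ ⟩
    n * n * (g * e⁶)                                     ≤⟨ *-monoʳ-≤ (n * n) ge⁶≤ ⟩
    n * n * (suc n * B * (p * p * p))                    ≡⟨ sort n (suc n) B p ⟩
    n * n * suc n * (p * p * p) * B
      ≤⟨ *-monoˡ-≤ B (*-mono-≤ (*-mono-≤ (*-mono-≤ n≤ n≤) 1+n≤) (*-mono-≤ (*-mono-≤ p≤64e p≤64e) p≤64e)) ⟩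
    c * e * (c * e) * (c * e) * (k * e * (k * e) * (k * e)) * B
                                                         ≡⟨ powers c k e B ⟩
    c * c * c * (k * k * k) * B * e⁶                     ∎)
    where
    c = 192
    k = 64
    e⁶ = e * e * (e * e) * (e * e)
    instance
      e≢0 : NonZero e
      e≢0 = >-nonZero 1≤e
      e²≢0 : NonZero (e * e)
      e²≢0 = m*n≢0 e e
      e⁴≢0 : NonZero (e * e * (e * e))
      e⁴≢0 = m*n≢0 (e * e) (e * e)
      e⁶≢0 : NonZero e⁶
      e⁶≢0 = m*n≢0 (e * e * (e * e)) (e * e)
      w≢0 : NonZero weight₀
      w≢0 = p !* q !≢0
    1+n≤ : suc n ≤ c * e
    1+n≤ = begin
      suc n                ≤⟨ s≤s n≤2p+1 ⟩
      suc (2 * p + 1)      ≤⟨ s≤s (+-monoˡ-≤ 1 (*-monoʳ-≤ 2 p≤64e)) ⟩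
      suc (2 * (64 * e) + 1) ≡⟨ shape₁ e ⟩
      128 * e + 2          ≤⟨ +-monoʳ-≤ (128 * e) (≤-trans (*-monoʳ-≤ 2 1≤e) (*-monoˡ-≤ e (m≤m+n 2 62))) ⟩
      128 * e + 64 * e     ≡⟨ *-distribʳ-+ e 128 64 ⟨
      c * e                ∎
      where
      shape₁ : ∀ e → suc (2 * (64 * e) + 1) ≡ 128 * e + 2
      shape₁ = solve-∀
    n≤ : n ≤ c * e
    n≤ = ≤-trans (n≤1+n n) 1+n≤
    pull : ∀ n g x → n * (n * g) * x ≡ n * n * (g * x)
    pull = solve-∀
    sort : ∀ n s B p → n * n * (s * B * (p * p * p)) ≡ n * n * s * (p * p * p) * B
    sort = solve-∀
    powers : ∀ c k e B → c * e * (c * e) * (c * e) * (k * e * (k * e) * (k * e)) * B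
           ≡ c * c * c * (k * k * k) * B * (e * e * (e * e) * (e * e))
    powers = solve-∀
    swap : ∀ g w x → g * x * w ≡ g * (w * x)
    swap = solve-∀
    unswap : ∀ s B w y → s * (B * w) * y ≡ s * B * y * w
    unswap = solve-∀
    ge⁶≤ : g * e⁶ ≤ suc n * B * (p * p * p)
    ge⁶≤ = *-cancelʳ-≤ _ _ weight₀ (begin
      g * e⁶ * weight₀                       ≡⟨ swap g weight₀ e⁶ ⟩
      g * (weight₀ * e⁶)                     ≤⟨ le ⟩
      suc n * n ! * (p * p * p)              ≡⟨ cong (λ y → suc n * y * (p * p * p)) B*w≡n! ⟨
      suc n * (B * weight₀) * (p * p * p)    ≡⟨ unswap (suc n) B weight₀ (p * p * p) ⟩
      suc n * B * (p * p * p) * weight₀      ∎)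

  -- Here d allows for the excess of x over q; it weakens the bound on the pairs and must be matched
  -- by the growth of the weight.
  middle-weight-at : ∀ x l d S → n ∸ x ≡ 2 + l → n ≤ 2 * (2 + l) + 2 * d + 1 → n ≤ 3 * (2 + l) →
    29 * e ≤ 2 + l → d ≤ n → weight₀ * (p + d * d) ≤ sizeWeight x * p →
    S ≤ r * ∑₁ (λ k → k ! * (n ∸ x ∸ k) !) (6 * e + 1) →
    n * n * (x ! * S) + n * n * weight₀ ≤ n * n * sizeWeight x + weight₀ * (2 * r * n + 72 * r)
  middle-weight-at x l d S n∸x≡ n≤2m n≤3m 29e≤m d≤n w≤ S≤ rewrite n∸x≡ =
    absorb-deviation n r d p (x ! * S) (x ! * (2 + l) !) weight₀ pairs≤ w≤ 2Y≤ 24rp≤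
    where
    -- This holds because 18 e + 2 ≤ 29 e ≤ l + 2.
    3J≤ : 3 * (6 * e + 1) ≤ 3 + l
    3J≤ = +-cancelˡ-≤ 2 _ _ (begin
      2 + 3 * (6 * e + 1)     ≡⟨ shape₁ e ⟩
      18 * e + 2 + 3
        ≤⟨ +-monoˡ-≤ 3 (+-monoʳ-≤ (18 * e) (≤-trans (*-monoʳ-≤ 2 1≤e) (*-monoˡ-≤ e (m≤m+n 2 9)))) ⟩
      18 * e + 11 * e + 3     ≡⟨ cong (_+ 3) (*-distribʳ-+ e 18 11) ⟨
      29 * e + 3              ≤⟨ +-monoˡ-≤ 3 29e≤m ⟩
      2 + l + 3               ≡⟨ shape₂ l ⟩
      2 + (3 + l)             ∎)
      where
      shape₁ : ∀ e → 2 + 3 * (6 * e + 1) ≡ 18 * e + 2 + 3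
      shape₁ = solve-∀
      shape₂ : ∀ l → 2 + l + 3 ≡ 2 + (3 + l)
      shape₂ = solve-∀
    pairs≤ : n * n * (x ! * S) ≤ x ! * (2 + l) ! * (r * (2 * n + 12 * d + 72))
    pairs≤ = begin
      n * n * (x ! * S)
        ≤⟨ *-monoʳ-≤ (n * n) (*-monoʳ-≤ (x !) (≤-trans S≤ (*-monoʳ-≤ r (∑₁-!*! l (6 * e + 1) 3J≤)))) ⟩
      n * n * (x ! * (r * ((l + 5) * l !)))            ≡⟨ front (n * n) (x !) r (l + 5) (l !) ⟩
      r * x ! * l ! * (n * n * (l + 5))
        ≤⟨ *-monoʳ-≤ (r * x ! * l !) (gap-ratio n l d n≤2m n≤3m) ⟩
      r * x ! * l ! * ((2 + l) * (1 + l) * (2 * n + 12 * d + 72))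
        ≡⟨ back r (x !) (l !) (2 + l) (1 + l) (2 * n + 12 * d + 72) ⟩
      x ! * ((2 + l) * ((1 + l) * l !)) * (r * (2 * n + 12 * d + 72)) ∎
      where
      front : ∀ a x r b y → a * (x * (r * (b * y))) ≡ r * x * y * (a * b)
      front = solve-∀
      back : ∀ r x y a b c → r * x * y * (a * b * c) ≡ x * (a * (b * y)) * (r * c)
      back = solve-∀
    -- The threshold constant is 172 = 2 (2 + 12 + 72).
    2Y≤ : 2 * (r * (2 * n + 12 * d + 72)) ≤ n * n
    2Y≤ = begin
      2 * (r * (2 * n + 12 * d + 72))
        ≤⟨ *-monoʳ-≤ 2 (*-monoʳ-≤ r (+-mono-≤ (+-monoʳ-≤ (2 * n) (*-monoʳ-≤ 12 d≤n)) (m≤m*n 72 n {{n≢0}}))) ⟩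
      2 * (r * (2 * n + 12 * n + 72 * n))  ≡⟨ shape r n ⟩
      172 * r * n                          ≤⟨ *-monoˡ-≤ n 172r≤n ⟩
      n * n                                ∎
      where
      shape : ∀ r n → 2 * (r * (2 * n + 12 * n + 72 * n)) ≡ 172 * r * n
      shape = solve-∀
    24rp≤ : 24 * r * p ≤ n * n
    24rp≤ = *-mono-≤ (≤-trans (*-monoˡ-≤ r (m≤m+n 24 148)) 172r≤n) p≤n

  29e≤⇒2≤ : ∀ {m} → 29 * e ≤ m → 2 ≤ m
  29e≤⇒2≤ le = ≤-trans (≤-trans (*-monoʳ-≤ 2 1≤e) (*-monoˡ-≤ e (m≤m+n 2 27))) le

  middle-weight : ∀ {x} → x ≤ n → Middle x → ∀ S →
    S ≤ r * ∑₁ (λ k → k ! * (n ∸ x ∸ k) !) (6 * e + 1) →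
    n * n * (x ! * S) + n * n * weight₀ ≤ n * n * sizeWeight x + weight₀ * (2 * r * n + 72 * r)
  middle-weight {x} x≤n (p≤ , ≤q) S S≤ with split x p+q≡n q≤1+p x≤n
  ... | low d x+d≡p n∸x≡ = go (29e≤⇒2≤ 29e≤)
    where
    29e≤ : 29 * e ≤ n ∸ x
    29e≤ = begin
      29 * e  ≤⟨ *-monoˡ-≤ e (m≤m+n 29 3) ⟩
      32 * e  ≤⟨ 32e≤p ⟩
      p       ≤⟨ p≤q ⟩
      q       ≤⟨ m≤m+n q d ⟩
      q + d   ≡⟨ n∸x≡ ⟨
      n ∸ x   ∎
    n≤2m : n ≤ 2 * (n ∸ x)
    n≤2m = begin
      n            ≡⟨ p+q≡n ⟨
      p + q        ≤⟨ +-mono-≤ (≤-trans p≤q (m≤m+n q d)) (m≤m+n q d) ⟩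
      q + d + (q + d) ≡⟨ shape (q + d) ⟩
      2 * (q + d)  ≡⟨ cong (2 *_) n∸x≡ ⟨
      2 * (n ∸ x)  ∎
      where
      shape : ∀ x → x + x ≡ 2 * x
      shape = solve-∀
    go : 2 ≤ n ∸ x → _
    go 2≤m with m≤n⇒∃[o]m+o≡n 2≤m
    ... | l , 2+l≡ = middle-weight-at x l 0 S (sym 2+l≡)
      (≤-trans (subst (λ m → n ≤ 2 * m) (sym 2+l≡) n≤2m) (≤-trans (m≤m+n _ 0) (m≤m+n _ 1)))
      (≤-trans (subst (λ m → n ≤ 2 * m) (sym 2+l≡) n≤2m) (*-monoˡ-≤ (2 + l) (m≤m+n 2 1)))
      (subst (29 * e ≤_) (sym 2+l≡) 29e≤) z≤n
      (begin
        weight₀ * (p + 0)         ≡⟨ cong₂ (λ a b → a ! * q ! * b) (sym x+d≡p) (+-identityʳ p) ⟩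
        (x + d) ! * q ! * p       ≤⟨ *-monoˡ-≤ p (!*!-mono d x q (≤-trans (≤-reflexive x+d≡p) p≤q)) ⟩
        x ! * (q + d) ! * p       ≡⟨ cong (λ m → x ! * m ! * p) n∸x≡ ⟨
        sizeWeight x * p          ∎) S≤
  ... | high d q+d≡x m+d≡p = go (29e≤⇒2≤ 29e≤)
    where
    d≤3e : d ≤ 3 * e
    d≤3e = +-cancelˡ-≤ q _ _ (≤-trans (≤-reflexive q+d≡x) ≤q)
    p≤m+3e : p ≤ n ∸ x + 3 * e
    p≤m+3e = ≤-trans (≤-reflexive (sym m+d≡p)) (+-monoʳ-≤ (n ∸ x) d≤3e)
    -- The complement falls short of p by at most 3 e, and 29 = 32 - 3.
    29e≤ : 29 * e ≤ n ∸ x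
    29e≤ = +-cancelʳ-≤ (3 * e) _ _ (begin
      29 * e + 3 * e    ≡⟨ *-distribʳ-+ e 29 3 ⟨
      32 * e            ≤⟨ 32e≤p ⟩
      p                 ≤⟨ p≤m+3e ⟩
      n ∸ x + 3 * e     ∎)
    n≤2m : n ≤ 2 * (n ∸ x) + 2 * d + 1
    n≤2m = ≤-trans n≤2p+1 (≤-reflexive (cong (_+ 1) (trans (cong (2 *_) (sym m+d≡p)) (*-distribˡ-+ 2 (n ∸ x) d))))
    n≤3m : n ≤ 3 * (n ∸ x)
    n≤3m = +-cancelʳ-≤ (9 * e) _ _ (begin
      n + 9 * e                   ≤⟨ +-monoˡ-≤ (9 * e) n≤2p+1 ⟩
      2 * p + 1 + 9 * e           ≡⟨ +-assoc (2 * p) 1 (9 * e) ⟩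
      2 * p + (1 + 9 * e)         ≤⟨ +-monoʳ-≤ (2 * p) (+-monoˡ-≤ (9 * e) 1≤e) ⟩
      2 * p + 10 * e              ≤⟨ +-monoʳ-≤ (2 * p) (≤-trans (*-monoˡ-≤ e (m≤m+n 10 22)) 32e≤p) ⟩
      2 * p + p                   ≡⟨ +-comm (2 * p) p ⟩
      3 * p                       ≤⟨ *-monoʳ-≤ 3 p≤m+3e ⟩
      3 * (n ∸ x + 3 * e)         ≡⟨ shape (n ∸ x) e ⟩
      3 * (n ∸ x) + 9 * e         ∎)
      where
      shape : ∀ m e → 3 * (m + 3 * e) ≡ 3 * m + 9 * e
      shape = solve-∀
    go : 2 ≤ n ∸ x → _
    go 2≤m with m≤n⇒∃[o]m+o≡n 2≤m
    ... | l , 2+l≡ = middle-weight-at x l d S (sym 2+l≡)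
      (subst (λ m → n ≤ 2 * m + 2 * d + 1) (sym 2+l≡) n≤2m)
      (subst (λ m → n ≤ 3 * m) (sym 2+l≡) n≤3m)
      (subst (29 * e ≤_) (sym 2+l≡) 29e≤)
      (≤-trans d≤3e (≤-trans 3e≤p p≤n))
      (begin
        weight₀ * (p + d * d)                     ≡⟨ cong (λ a → a ! * q ! * (p + d * d)) m+d≡p ⟨
        (n ∸ x + d) ! * q ! * (p + d * d)
          ≤⟨ !*!-growth d (n ∸ x) q p (≤-trans (≤-reflexive m+d≡p) p≤q) (≤-reflexive m+d≡p) ⟩
        (n ∸ x) ! * (q + d) ! * p                 ≡⟨ cong (_* p) (*-comm ((n ∸ x) !) ((q + d) !)) ⟩
        (q + d) ! * (n ∸ x) ! * p                 ≡⟨ cong (λ y → y ! * (n ∸ x) ! * p) q+d≡x ⟩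
        sizeWeight x * p                          ∎) S≤

  -- The window of middle sizes has length 6 e + (q - p), where q - p is at most 1.
  spread : ∀ {x y} → Middle x → Middle y → y ≤ x + (6 * e + 1)
  spread {x} {y} (p≤ , _) (_ , y≤) = begin
    y                         ≤⟨ y≤ ⟩
    q + 3 * e                 ≤⟨ +-monoˡ-≤ (3 * e) (≤-trans q≤1+p (s≤s p≤)) ⟩
    suc (x + 3 * e) + 3 * e   ≡⟨ shape x e ⟩
    x + (6 * e + 1)           ∎
    where
    shape : ∀ x e → suc (x + 3 * e) + 3 * e ≡ x + (6 * e + 1)
    shape = solve-∀

-- Adding up the middle part and the tail of the family

HasConfig-⊆ : ∀ {s n} {F G : List (Subset n)} → (∀ {X} → X ∈ F → X ∈ G) → HasConfig s n F → HasConfig s n G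
HasConfig-⊆ F⊆G (B , C , B∈ , C∈ , rest) = B , C , F⊆G B∈ , (λ i → F⊆G (C∈ i)) , rest

tailConstant : ℕ
tailConstant = 192 * 192 * 192 * (64 * 64 * 64)

errorConstant : ℕ → ℕ
errorConstant r = 296 * (r * r) + 144 * r + tailConstant

module Bound (n p q e r : ℕ) (p+q≡n : p + q ≡ n) (p≤q : p ≤ q) (q≤1+p : q ≤ suc p)
             (1≤e : 1 ≤ e) (32e≤p : 32 * e ≤ p) (p≤64e : p ≤ 64 * e) (172r≤n : 172 * r ≤ n)
             (B : ℕ) (B*weight₀≡n! : B * (p ! * q !) ≡ n !)
             (F : List (Subset n)) (F! : Unique F) (noConfig : ¬ HasConfig (suc r) n F) where
  open Sizes n p q e r p+q≡n p≤q q≤1+p 1≤e 32e≤p p≤64e 172r≤n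

  middleSet? : Decidable (λ (X : Subset n) → Middle ∣ X ∣)
  middleSet? X = middle? ∣ X ∣

  M L : List (Subset n)
  M = filter middleSet? F
  L = filter (∁? middleSet?) F

  M! : Unique M
  M! = filter⁺ middleSet? F!

  open Chains M M!
  open Levels M M! r (noConfig ∘ HasConfig-⊆ (proj₁ ∘ ∈-filter⁻ middleSet?))

  middle-∈ : ∀ {X} → X ∈ M → Middle ∣ X ∣
  middle-∈ X∈M = proj₂ (∈-filter⁻ middleSet? {xs = F} X∈M)

  -- Summing `middle-weight` over M and applying `lym-with-pairs` leaves n² P on both sides. The
  -- pair total cancels, and division by `weight₀` turns n! into B.
  middle-bound : length M * (n * n) ≤ n * n * B + length M * (2 * r * n + 72 * r)
  middle-bound = *-cancelʳ-≤ _ _ weight₀ {{p !* q !≢0}} (+-cancelˡ-≤ (n * n * P) _ _ (begin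
    n * n * P + length M * (n * n) * weight₀
      ≡⟨ cong₂ _+_ (sym (∑-*ˡ M (n * n) pairs)) (trans (*-assoc (length M) _ _) (sym (∑-const M _))) ⟩
    ∑ M (λ X → n * n * pairs X) + ∑ M (λ _ → n * n * weight₀)
      ≡⟨ ∑-+ M _ _ ⟨
    ∑ M (λ X → n * n * pairs X + n * n * weight₀)
      ≤⟨ ∑-mono M (λ {X} X∈M → middle-weight (∣p∣≤n X) (middle-∈ X∈M) (supersets X)
           (supersets-≤ (6 * e + 1) (λ X∈ Y∈ → spread (middle-∈ X∈) (middle-∈ Y∈)) X∈M)) ⟩
    ∑ M (λ X → n * n * weight X + weight₀ * c)
      ≡⟨ ∑-+ M _ _ ⟩
    ∑ M (λ X → n * n * weight X) + ∑ M (λ _ → weight₀ * c)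
      ≡⟨ cong₂ _+_ (∑-*ˡ M (n * n) weight) (∑-const M _) ⟩
    n * n * ∑ M weight + length M * (weight₀ * c)
      ≤⟨ +-monoˡ-≤ _ (*-monoʳ-≤ (n * n) lym-with-pairs) ⟩
    n * n * (n ! + P) + length M * (weight₀ * c)
      ≡⟨ cong (λ y → n * n * (y + P) + length M * (weight₀ * c)) B*weight₀≡n! ⟨
    n * n * (B * weight₀ + P) + length M * (weight₀ * c)
      ≡⟨ shape (n * n) B weight₀ P (length M) c ⟩
    n * n * P + (n * n * B + length M * c) * weight₀ ∎))
    where
    pairs : Subset n → ℕ
    pairs X = ∣ X ∣ ! * supersets X
    P = ∑ M pairs
    c = 2 * r * n + 72 * r
    shape : ∀ a B w P m c → a * (B * w + P) + m * (w * c) ≡ a * P + (a * B + m * c) * w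
    shape = solve-∀

  tail-bound : n * (n * length L) ≤ tailConstant * B
  tail-bound = tail-size (length L) B B*weight₀≡n! (begin
    length L * z                                      ≡⟨ ∑-const L z ⟨
    ∑ L (λ _ → z)
      ≤⟨ ∑-mono L (λ {X} X∈L → tail-weight (∣p∣≤n X) (proj₂ (∈-filter⁻ (∁? middleSet?) {xs = F} X∈L))) ⟩
    ∑ L (λ X → sizeWeight ∣ X ∣ * (p * p * p))        ≡⟨ ∑-cong L (λ X → *-comm _ (p * p * p)) ⟩
    ∑ L (λ X → p * p * p * sizeWeight ∣ X ∣)          ≡⟨ ∑-*ˡ L (p * p * p) _ ⟩
    p * p * p * ∑ L (sizeWeight ∘ ∣_∣)
      ≤⟨ *-monoʳ-≤ (p * p * p) (Chains.lym-crude L (filter⁺ (∁? middleSet?) F!)) ⟩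
    p * p * p * (suc n * n !)                         ≡⟨ *-comm (p * p * p) _ ⟩
    suc n * n ! * (p * p * p)                         ∎)
    where
    z = weight₀ * (e * e * (e * e) * (e * e))

  family-bound : n * (n * length F) ≤ n * ((n + 2 * r) * B) + errorConstant r * B
  family-bound = begin
    n * (n * length F)
      ≡⟨ cong (λ y → n * (n * y)) (length-filter-∁ middleSet? F) ⟩
    n * (n * (length M + length L))                  ≡⟨ distrib n (length M) (length L) ⟩
    n * (n * length M) + n * (n * length L)
      ≤⟨ +-mono-≤ (bootstrap n r (length M) B {{n≢0}} 172r≤n middle-bound) tail-bound ⟩
    n * ((n + 2 * r) * B) + c * B + tailConstant * B ≡⟨ +-assoc (n * ((n + 2 * r) * B)) (c * B) _ ⟩
    n * ((n + 2 * r) * B) + (c * B + tailConstant * B)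
      ≡⟨ cong (n * ((n + 2 * r) * B) +_) (*-distribʳ-+ B c tailConstant) ⟨
    n * ((n + 2 * r) * B) + errorConstant r * B      ∎
    where
    c = 296 * (r * r) + 144 * r
    distrib : ∀ n a b → n * (n * (a + b)) ≡ n * (n * a) + n * (n * b)
    distrib = solve-∀

-- Choice of the parameters and the final estimate

module Halves (n : ℕ) (64≤n : 64 ≤ n) where
  p q e : ℕ
  p = n / 2
  q = n ∸ p
  e = p / 32

  p≤n : p ≤ n
  p≤n = ≤-trans (m≤m*n p 2) (m/n*n≤m n 2)

  p+q≡n : p + q ≡ n
  p+q≡n = m+[n∸m]≡n p≤n

  p+p≤n : p + p ≤ n
  p+p≤n = ≤-trans (≤-reflexive (shape p)) (m/n*n≤m n 2)
    where
    shape : ∀ p → p + p ≡ p * 2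
    shape = solve-∀

  p≤q : p ≤ q
  p≤q = m+n≤o⇒m≤o∸n p p+p≤n

  q≤1+p : q ≤ suc p
  q≤1+p = +-cancelˡ-≤ p _ _ (begin
    p + q               ≡⟨ p+q≡n ⟩
    n                   ≡⟨ m≡m%n+[m/n]*n n 2 ⟩
    n % 2 + p * 2       ≤⟨ +-monoˡ-≤ (p * 2) (s≤s⁻¹ (m%n<n n 2)) ⟩
    1 + p * 2           ≡⟨ shape p ⟩
    p + suc p           ∎)
    where
    shape : ∀ p → 1 + p * 2 ≡ p + suc p
    shape = solve-∀

  32≤p : 32 ≤ p
  32≤p = /-monoˡ-≤ 2 64≤n

  1≤e : 1 ≤ e
  1≤e = /-monoˡ-≤ 32 32≤p

  32e≤p : 32 * e ≤ p
  32e≤p = ≤-trans (≤-reflexive (*-comm 32 e)) (m/n*n≤m p 32)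

  p≤64e : p ≤ 64 * e
  p≤64e = begin
    p                  ≡⟨ m≡m%n+[m/n]*n p 32 ⟩
    p % 32 + e * 32    ≤⟨ +-monoˡ-≤ (e * 32) (<⇒≤ (m%n<n p 32)) ⟩
    -- The remainder modulo 32 is paid for by e ≥ 1, which rests on n ≥ 64.
    32 + e * 32        ≡⟨ cong (32 +_) (*-comm e 32) ⟩
    32 + 32 * e        ≤⟨ +-monoˡ-≤ (32 * e) (*-monoʳ-≤ 32 1≤e) ⟩
    32 * e + 32 * e    ≡⟨ *-distribʳ-+ e 32 32 ⟨
    64 * e             ∎

-- The relative error obtained is O(1/n²), so √(log n) enters only through log n ≥ 1.
squared-deviation : ∀ n r K f B → .{{_ : NonZero n}} → 1 ≤ ⌊log₂ n ⌋ →
  n * (n * f) ≤ n * ((n + 2 * r) * B) + K * B →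
  sq∸ (n * f) ((n + 2 * r) * B) * n ≤ K * K * ⌊log₂ n ⌋ * (B * B)
squared-deviation n r K f B 1≤log le = begin
  -- One more factor n completes the square of n D. Truncated subtraction makes D zero when the
  -- family is below the main term.
  D * D * n                       ≤⟨ m≤m*n (D * D * n) n ⟩
  D * D * n * n                   ≡⟨ square n D ⟩
  n * D * (n * D)                 ≤⟨ *-mono-≤ nD≤ nD≤ ⟩
  K * B * (K * B)                 ≡⟨ rearrange K B ⟩
  K * K * 1 * (B * B)             ≤⟨ *-monoˡ-≤ (B * B) (*-monoʳ-≤ (K * K) 1≤log) ⟩
  K * K * ⌊log₂ n ⌋ * (B * B)     ∎
  where
  D = n * f ∸ (n + 2 * r) * B
  nD≤ : n * D ≤ K * B
  nD≤ = begin
    n * D                                     ≡⟨ *-distribˡ-∸ n (n * f) ((n + 2 * r) * B) ⟩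
    n * (n * f) ∸ n * ((n + 2 * r) * B)       ≤⟨ m≤n+o⇒m∸n≤o (n * (n * f)) (n * ((n + 2 * r) * B)) le ⟩
    K * B                                     ∎
  square : ∀ n D → D * D * n * n ≡ n * D * (n * D)
  square = solve-∀
  rearrange : ∀ K B → K * B * (K * B) ≡ K * K * 1 * (B * B)
  rearrange = solve-∀

theorem2p7 : (s : ℕ) → s ≥ 1 →
    Σ ℕ λ K → Σ ℕ λ N → (n : ℕ) → n ≥ N →
    (F : List (Subset n)) → Unique F → ¬ HasConfig s n F →
    sq∸ (n * length F) ((n + 2 * (s ∸ 1)) * (n C (n / 2))) * n
    ≤ K * ⌊log₂ n ⌋ * ((n C (n / 2)) * (n C (n / 2)))
-- The constant is squared like the deviation. The threshold gives both n ≥ 64, for the choice of e,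
-- and n ≥ 172 r, for absorbing the errors.
theorem2p7 (suc r) _ = errorConstant r * errorConstant r , 64 + 172 * r , λ n n≥N F F! noConfig →
  let
    64≤n   = ≤-trans (m≤m+n 64 (172 * r)) n≥N
    172r≤n = ≤-trans (m≤n+m (172 * r) 64) n≥N
    open Halves n 64≤n
  in
  squared-deviation n r (errorConstant r) (length F) (n C p) {{>-nonZero (≤-trans (s≤s z≤n) 64≤n)}}
    (⌊log₂⌋-mono-≤ {2} (≤-trans (s≤s (s≤s z≤n)) 64≤n))
    (Bound.family-bound n p q e r p+q≡n p≤q q≤1+p 1≤e 32e≤p p≤64e 172r≤n
      (n C p) (C*k!*[n∸k]!≡n! p≤n) F F! noConfig)
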